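{- For every real $c>0$ and every positive integer $d$, there exists a finite connected graph $G$ without isolated vertices, of diameter at least $d$, such that $$\gamma_{\mathrm{pr}}(G\times G) < c\,\gamma_{\mathrm{pr}}(G)^2.$$
   Context: All graphs are finite, simple and undirected. The direct product $G\times H$ has vertex set $V(G)\times V(H)$, with $(u_G,u_H)$ adjacent to $(v_G,v_H)$ iff $u_Gv_G\in E(G)$ and $u_Hv_H\in E(H)$. A set $D\subseteq V(G)$ is dominating if every vertex of $G$ is in $D$ or adjacent to a vertex of $D$. For a graph without isolated vertices, the paired domination number $\gamma_{\mathrm{pr}}(G)$ is the minimum size of a dominating set $D$ such that the induced subgraph $G[D]$ has a perfect matching. -}

module Defs where

open import Data.Bool using (Bool; true; false; _∧_)
open import Data.Nat using (ℕ; zero; suc; _*_; _≤_)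
open import Data.Fin using (Fin; remQuot)
open import Data.Fin.Subset using (Subset; _∈_; ∣_∣)
open import Data.Product using (Σ; ∃; ∃-syntax; _×_; _,_; proj₁; proj₂)
open import Data.Sum using (_⊎_)
open import Relation.Binary.PropositionalEquality using (_≡_; refl)

record Graph (n : ℕ) : Set where
  field
    adj     : Fin n → Fin n → Bool
    symm    : ∀ u v → adj u v ≡ adj v u
    irrefl  : ∀ v → adj v v ≡ false

open Graph public

Adj : ∀ {n} → Graph n → Fin n → Fin n → Set
Adj G u v = adj G u v ≡ true

π₁ : ∀ {n} m → Fin (n * m) → Fin n
π₁ {n} m x = proj₁ (remQuot {n} m x)

π₂ : ∀ {n} m → Fin (n * m) → Fin m
π₂ {n} m x = proj₂ (remQuot {n} m x)

∧-cong : ∀ {a b c d : Bool} → a ≡ b → c ≡ d → (a ∧ c) ≡ (b ∧ d)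
∧-cong refl refl = refl

∧-false : ∀ {a c : Bool} → a ≡ false → (a ∧ c) ≡ false
∧-false {false} _ = refl
∧-false {true} ()

_×ᵍ_ : ∀ {n m} → Graph n → Graph m → Graph (n * m)
_×ᵍ_ {n} {m} G H = record
  { adj    = λ x y → adj G (π₁ {n} m x) (π₁ {n} m y) ∧ adj H (π₂ {n} m x) (π₂ {n} m y)
  ; symm   = λ x y → ∧-cong (symm G (π₁ {n} m x) (π₁ {n} m y)) (symm H (π₂ {n} m x) (π₂ {n} m y))
  ; irrefl = λ x → ∧-false (irrefl G (π₁ {n} m x))
  }

NoIsolated : ∀ {n} → Graph n → Set
NoIsolated G = ∀ v → ∃[ u ] Adj G v u

data Walk {n} (G : Graph n) : Fin n → Fin n → ℕ → Set where
  [] : ∀ {v} → Walk G v v zero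
  _∷_ : ∀ {u v w k} → Adj G u v → Walk G v w k → Walk G u w (suc k)

Connected : ∀ {n} → Graph n → Set
Connected G = ∀ u v → ∃[ k ] Walk G u v k

Dist : ∀ {n} → Graph n → Fin n → Fin n → ℕ → Set
Dist G u v k = Walk G u v k × (∀ l → Walk G u v l → k ≤ l)

Diameter : ∀ {n} → Graph n → ℕ → Set
Diameter G D = (∃[ u ] ∃[ v ] Dist G u v D) × (∀ u v k → Dist G u v k → k ≤ D)

Dominating : ∀ {n} → Graph n → Subset n → Set
Dominating G D = ∀ v → v ∈ D ⊎ (∃[ u ] (u ∈ D × Adj G v u))

HasPerfectMatching : ∀ {n} → Graph n → Subset n → Set
HasPerfectMatching {n} G D =
  Σ (Fin n → Fin n) λ p →
    ∀ v → v ∈ D → (p v ∈ D) × Adj G v (p v) × (p (p v) ≡ v)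

PairedDominating : ∀ {n} → Graph n → Subset n → Set
PairedDominating G D = Dominating G D × HasPerfectMatching G D

PairedDomNumber : ∀ {n} → Graph n → ℕ → Set
PairedDomNumber G k =
  (∃[ D ] (PairedDominating G D × ∣ D ∣ ≡ k))
  × (∀ D → PairedDominating G D → k ≤ ∣ D ∣)

{-# OPTIONS --safe #-}
module Submission where

-- The vectors x that detect a (x · a = 1) over F₂ form a hypergraph whose transversals are the
-- spanning sets of F₂ⁿ, so n vectors are needed to detect every a ≠ 0. Pairs (a , b) with a, b ≠ 0 are
-- detected by fewer than n² pairs of vectors: for n = 2^j, the products computed by Karatsuba's
-- algorithm are such a family of size 3^j. The hypergraph is realised by a graph G in which the
-- vectors a have only the vectors x as neighbours and every other vertex is dominated by a number
-- of vertices depending on d alone. Then γpr(G) ≥ n while γpr(G × G) = O(3^j), against n² = 4^j.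
-- Doubling every vertex lets a dominating set of G be matched perfectly.

open import Defs
open import Data.Bool using (Bool; true; false; _∧_; _∨_; _xor_; not)
open import Data.Bool.Properties using (∧-zeroʳ; ∧-comm; xor-comm; xor-assoc; xor-same;
  not-involutive) renaming (_≟_ to _≟ᵇ_)
open import Data.Bool.Solver using (module xor-∧-Solver)
open import Data.Fin using (Fin; zero; suc; toℕ; fromℕ; inject₁; finToFun; funToFin)
open import Data.Fin.Induction using (<-weakInduction)
open import Data.Fin.Properties using (any?; all?; 2↔Bool; *↔×; remQuot-combine; finToFun-funToFin;
  toℕ-inject₁; toℕ-fromℕ; _≟_)
open import Data.Fin.Subset using (Subset; inside; outside; ⁅_⁆; ⊥; _∪_; ∣_∣) renaming (_∈_ to _∈ˢ_)
open import Data.Fin.Subset.Properties using (anySubset?; ∣⊥∣≡0; ∪-identityˡ; x∈⁅x⁆; x∈p∪q⁺; x∈p∪q⁻;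
  x∈⁅y⁆⇒x≡y; ∉⊥) renaming (_∈?_ to _∈ˢ?_)
open import Data.List using (List; []; _∷_; _++_; map; length; foldr; allFin; cartesianProduct;
  cartesianProductWith)
open import Data.List.Extrema.Nat using (argmax; f[xs]≤f[argmax])
open import Data.List.Membership.Propositional using (_∈_; find; lose)
open import Data.List.Membership.Propositional.Properties using (∈-map⁺; ∈-map⁻; ∈-allFin;
  ∈-cartesianProduct⁺; ∈-cartesianProduct⁻)
open import Data.List.Properties using (length-++; length-map; length-tabulate)
open import Data.List.Relation.Unary.All as All using (All; []; _∷_)
import Data.List.Relation.Unary.All.Properties as Allₚ
open import Data.List.Relation.Unary.Any as Any using (Any; here; there)
import Data.List.Relation.Unary.Any.Properties as Anyₚ
open import Data.Nat using (ℕ; zero; suc; _+_; _*_; _^_; _≤_; _<_; _≡ᵇ_; z≤n; s≤s)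
open import Data.Nat.Properties using (≤-refl; ≤-trans; ≤-reflexive; ≤-pred; ≮⇒≥; n≤1+n; m≤m+n;
  +-mono-≤; +-monoʳ-≤; +-monoˡ-≤; *-mono-≤; *-monoʳ-≤; *-monoˡ-≤; *-cancelˡ-<; *-distribʳ-+;
  +-identityʳ; *-identityʳ; module ≤-Reasoning) renaming (_≟_ to _≟ⁿ_)
open import Data.Nat.Tactic.RingSolver using (solve-∀)
open import Data.Product using (Σ; ∃-syntax; _×_; _,_; proj₁; proj₂; map₂; uncurry)
open import Data.Product.Function.NonDependent.Propositional using (_×-↔_)
open import Data.Sum using (_⊎_; inj₁; inj₂)
open import Data.Vec using (Vec; []; _∷_; replicate; splitAt; uncons; here; there) renaming (_++_ to
  _++ᵛ_)
open import Function using (_∘_; id)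
open import Function.Bundles using (_↔_; mk↔ₛ′; Inverse)
open import Function.Construct.Composition using (_↔-∘_)
open import Function.Construct.Identity using (↔-id)
open import Function.Construct.Symmetry using (↔-sym)
open import Relation.Binary.PropositionalEquality using (_≡_; refl; sym; trans; cong; cong₂; subst;
  subst₂)
open import Relation.Nullary using (Dec; yes; no; contradiction)
open import Relation.Nullary.Decidable using (map′; _×-dec_; _⊎-dec_; _→-dec_)
open import Relation.Unary using (Decidable)

open xor-∧-Solver using (solve; _:+_; _:*_; _:=_)

-- Decidable search

least : {P : ℕ → Set} → Decidable P → ∀ k → P k → ∃[ m ] (P m × ∀ l → P l → m ≤ l)
least P? zero pk = zero , pk , λ _ _ → z≤n
least P? (suc k) pk with P? zero
... | yes p₀ = zero , p₀ , λ _ _ → z≤n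
... | no ¬p₀ with least (P? ∘ suc) k pk
... | m , pm , m≤ = suc m , pm , λ { zero p₀ → contradiction p₀ ¬p₀ ; (suc l) pl → s≤s (m≤ l pl) }

walk? : ∀ {n} (G : Graph n) k u v → Dec (Walk G u v k)
walk? G zero u v = map′ (λ { refl → [] }) (λ { [] → refl }) (u ≟ v)
walk? G (suc k) u v =
  map′ (λ (_ , e , w) → e ∷ w) (λ { (e ∷ w) → _ , e , w })
    (any? λ w → (adj G u w ≟ᵇ true) ×-dec walk? G k w v)

distance : ∀ {n} (G : Graph n) → Connected G → ∀ u v → ∃[ k ] Dist G u v k
distance G conn u v = least (λ k → walk? G k u v) (proj₁ (conn u v)) (proj₂ (conn u v))

diameter : ∀ {n} (G : Graph n) → Connected G → Fin n →
           ∃[ D ] (Diameter G D × ∀ u v k → Dist G u v k → k ≤ D)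
diameter {n} G conn v₀ = f best , ((_ , _ , proj₂ (distance G conn _ _)) , bound) , bound
  where
  f : Fin n × Fin n → ℕ
  f (u , v) = proj₁ (distance G conn u v)
  pairs = cartesianProduct (allFin n) (allFin n)
  -- The default pair `(v₀ , v₀)` is itself a pair of vertices, so the maximum is an attained
  -- distance.
  best = argmax f (v₀ , v₀) pairs
  bound : ∀ u v k → Dist G u v k → k ≤ f best
  bound u v k (_ , k≤) = ≤-trans (k≤ _ (proj₁ (proj₂ (distance G conn u v))))
    (All.lookup (f[xs]≤f[argmax] (v₀ , v₀) pairs) (∈-cartesianProduct⁺ (∈-allFin u) (∈-allFin v)))

-- Partner functions are searched through their codes in a finite type. Decoding agrees with the
-- original function only pointwise, so `respects` transfers the matching conditions at `v` and at
-- its partner.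
hasPerfectMatching? : ∀ {n} (G : Graph n) D → Dec (HasPerfectMatching G D)
hasPerfectMatching? {n} G D =
  map′ (λ (c , m) → finToFun c , m)
       (λ (p , m) → funToFin p , λ v v∈D → respects p v (m v v∈D))
       (any? λ c → all? λ v → (v ∈ˢ? D) →-dec
         ((finToFun c v ∈ˢ? D) ×-dec (adj G v (finToFun c v) ≟ᵇ true)
           ×-dec (finToFun c (finToFun c v) ≟ v)))
  where
  respects : ∀ p v → p v ∈ˢ D × Adj G v (p v) × p (p v) ≡ v →
             let p′ = finToFun (funToFin p) in p′ v ∈ˢ D × Adj G v (p′ v) × p′ (p′ v) ≡ v
  respects p v m rewrite finToFun-funToFin p v | finToFun-funToFin p (p v) = m

pairedDominating? : ∀ {n} (G : Graph n) D → Dec (PairedDominating G D)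
pairedDominating? G D =
  (all? λ v → (v ∈ˢ? D) ⊎-dec any? λ u → (u ∈ˢ? D) ×-dec (adj G v u ≟ᵇ true))
  ×-dec hasPerfectMatching? G D

pairedDomNumber : ∀ {n} (G : Graph n) D → PairedDominating G D →
                  ∃[ k ] (PairedDomNumber G k × k ≤ ∣ D ∣)
pairedDomNumber G D pd =
  let k , ex , k≤ = least (λ k → anySubset? λ D → pairedDominating? G D ×-dec (∣ D ∣ ≟ⁿ k))
                      ∣ D ∣ (D , pd , refl)
  in k , (ex , λ D′ pd′ → k≤ _ (D′ , pd′ , refl)) , k≤ _ (D , pd , refl)

-- A vertex of `D` is adjacent to its own partner. The lower bound may thus use a neighbour in `D`
-- for every vertex.
paired⇒totally : ∀ {n} (G : Graph n) D → PairedDominating G D → ∀ v → ∃[ u ] (u ∈ˢ D × Adj G v u)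
paired⇒totally G D (dom , p , m) v with dom v
... | inj₁ v∈D = let pv∈D , e , _ = m v v∈D in p v , pv∈D , e
... | inj₂ u = u

-- Subsets and lists

fromList : ∀ {n} → List (Fin n) → Subset n
fromList = foldr (λ x p → ⁅ x ⁆ ∪ p) ⊥

∣⁅x⁆∪p∣≤ : ∀ {n} (x : Fin n) p → ∣ ⁅ x ⁆ ∪ p ∣ ≤ suc ∣ p ∣
∣⁅x⁆∪p∣≤ zero (inside ∷ p) rewrite ∪-identityˡ p = n≤1+n _
∣⁅x⁆∪p∣≤ zero (outside ∷ p) rewrite ∪-identityˡ p = ≤-refl
∣⁅x⁆∪p∣≤ (suc x) (inside ∷ p) = s≤s (∣⁅x⁆∪p∣≤ x p)
∣⁅x⁆∪p∣≤ (suc x) (outside ∷ p) = ∣⁅x⁆∪p∣≤ x p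

-- Only an inequality, because repeated entries merge.
∣fromList∣≤length : ∀ {n} (xs : List (Fin n)) → ∣ fromList xs ∣ ≤ length xs
∣fromList∣≤length {n} [] = ≤-reflexive (∣⊥∣≡0 n)
∣fromList∣≤length (x ∷ xs) = ≤-trans (∣⁅x⁆∪p∣≤ x _) (s≤s (∣fromList∣≤length xs))

∈-fromList⁺ : ∀ {n} {x : Fin n} {xs} → x ∈ xs → x ∈ˢ fromList xs
∈-fromList⁺ {x = x} (here refl) = x∈p∪q⁺ (inj₁ (x∈⁅x⁆ x))
∈-fromList⁺ (there x∈xs) = x∈p∪q⁺ (inj₂ (∈-fromList⁺ x∈xs))

∈-fromList⁻ : ∀ {n} {x : Fin n} xs → x ∈ˢ fromList xs → x ∈ xs
∈-fromList⁻ [] x∈ = contradiction x∈ ∉⊥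
∈-fromList⁻ (y ∷ xs) x∈ with x∈p∪q⁻ ⁅ y ⁆ (fromList xs) x∈
... | inj₁ x∈y = here (x∈⁅y⁆⇒x≡y y x∈y)
... | inj₂ x∈xs = there (∈-fromList⁻ xs x∈xs)

elements : ∀ {n} → Subset n → List (Fin n)
elements [] = []
elements (inside ∷ p) = zero ∷ map suc (elements p)
elements (outside ∷ p) = map suc (elements p)

length-elements : ∀ {n} (p : Subset n) → length (elements p) ≡ ∣ p ∣
length-elements [] = refl
length-elements (inside ∷ p) = cong suc (trans (length-map suc (elements p)) (length-elements p))
length-elements (outside ∷ p) = trans (length-map suc (elements p)) (length-elements p)

∈-elements : ∀ {n} {x : Fin n} {p} → x ∈ˢ p → x ∈ elements p
∈-elements {p = inside ∷ p} here = here refl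
∈-elements {p = inside ∷ p} (there x∈p) = there (∈-map⁺ suc (∈-elements x∈p))
∈-elements {p = outside ∷ p} (there x∈p) = ∈-map⁺ suc (∈-elements x∈p)

length-cartesianProductWith : ∀ {A B C : Set} (f : A → B → C) xs ys →
  length (cartesianProductWith f xs ys) ≡ length xs * length ys
length-cartesianProductWith f [] ys = refl
length-cartesianProductWith f (x ∷ xs) ys =
  trans (length-++ (map (f x) ys))
    (cong₂ _+_ (length-map (f x) ys) (length-cartesianProductWith f xs ys))

-- Linear algebra over the field with two elements

∧-true⁻ : ∀ {a b} → a ∧ b ≡ true → a ≡ true × b ≡ true
∧-true⁻ {true} {true} _ = refl , refl

zeros : ∀ n → Vec Bool n
zeros n = replicate n false

isZero : ∀ {n} → Vec Bool n → Bool
isZero [] = true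
isZero (b ∷ u) = not b ∧ isZero u

isZero-zeros : ∀ n → isZero (zeros n) ≡ true
isZero-zeros zero = refl
isZero-zeros (suc n) = isZero-zeros n

isZero-++ : ∀ {m n} (u : Vec Bool m) {v : Vec Bool n} → isZero (u ++ᵛ v) ≡ isZero u ∧ isZero v
isZero-++ [] = refl
isZero-++ (true ∷ u) = refl
isZero-++ (false ∷ u) = isZero-++ u

dot : ∀ {n} → Vec Bool n → Vec Bool n → Bool
dot [] [] = false
dot (x ∷ u) (y ∷ v) = (x ∧ y) xor dot u v

_⊕_ : ∀ {n} → Vec Bool n → Vec Bool n → Vec Bool n
[] ⊕ [] = []
(x ∷ u) ⊕ (y ∷ v) = (x xor y) ∷ (u ⊕ v)

dot-isZeroˡ : ∀ {n} (u v : Vec Bool n) → isZero u ≡ true → dot u v ≡ false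
dot-isZeroˡ [] [] _ = refl
dot-isZeroˡ (false ∷ u) (_ ∷ v) z = dot-isZeroˡ u v z

dot-comm : ∀ {n} (u v : Vec Bool n) → dot u v ≡ dot v u
dot-comm [] [] = refl
dot-comm (x ∷ u) (y ∷ v) = cong₂ _xor_ (∧-comm x y) (dot-comm u v)

dot-zerosʳ : ∀ {n} (u : Vec Bool n) → dot u (zeros n) ≡ false
dot-zerosʳ {n} u = trans (dot-comm u (zeros n)) (dot-isZeroˡ (zeros n) u (isZero-zeros n))

dot-⊕ˡ : ∀ {n} (u v w : Vec Bool n) → dot (u ⊕ v) w ≡ dot u w xor dot v w
dot-⊕ˡ [] [] [] = refl
dot-⊕ˡ (x ∷ u) (y ∷ v) (z ∷ w) rewrite dot-⊕ˡ u v w =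
  solve 5 (λ x y z a b → ((x :+ y) :* z) :+ (a :+ b) := ((x :* z) :+ a) :+ ((y :* z) :+ b))
    refl x y z (dot u w) (dot v w)

dot-++ : ∀ {m n} (u x : Vec Bool m) {v y : Vec Bool n} →
         dot (u ++ᵛ v) (x ++ᵛ y) ≡ dot u x xor dot v y
dot-++ [] [] = refl
dot-++ (a ∷ u) (b ∷ x) = trans (cong ((a ∧ b) xor_) (dot-++ u x)) (sym (xor-assoc (a ∧ b) _ _))

_⊥ᵛ_ : ∀ {n} → Vec Bool n → Vec Bool n → Set
x ⊥ᵛ a = dot x a ≡ false

-- Adding the pivot `true ∷ p` clears a leading `true`; the first coordinate is then dropped.
reduce : ∀ {n} → Vec Bool n → Vec Bool (suc n) → Vec Bool n
reduce p (false ∷ y) = y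
reduce p (true ∷ y) = y ⊕ p

-- One step of Gaussian elimination; the second alternative records a pivot true ∷ p.
eliminate : ∀ {n} (xs : List (Vec Bool (suc n))) →
  All (_⊥ᵛ (true ∷ zeros n)) xs ⊎
  (∃[ p ] ∃[ ys ] (suc (length ys) ≡ length xs ×
    (∀ a → All (_⊥ᵛ a) ys → All (_⊥ᵛ (dot p a ∷ a)) xs)))
eliminate [] = inj₁ []
eliminate ((true ∷ p) ∷ xs) =
  inj₂ (p , map (reduce p) xs , cong suc (length-map (reduce p) xs) ,
    -- The leading coordinate `dot p a` is the one that makes the pivot orthogonal to the extended
    -- vector.
    λ a ⊥ys → xor-same (dot p a) ∷ All.map (λ {x} → lift a x) (Allₚ.map⁻ ⊥ys))
  where
  lift : ∀ a x → reduce p x ⊥ᵛ a → x ⊥ᵛ (dot p a ∷ a)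
  lift a (false ∷ y) y⊥ = y⊥
  lift a (true ∷ y) y⊥ = trans (xor-comm (dot p a) (dot y a)) (trans (sym (dot-⊕ˡ y p a)) y⊥)
eliminate ((false ∷ x) ∷ xs) with eliminate xs
... | inj₁ ⊥xs = inj₁ (dot-zerosʳ x ∷ ⊥xs)
... | inj₂ (p , ys , len , f) =
  inj₂ (p , x ∷ ys , cong suc len , λ { a (x⊥ ∷ ⊥ys) → x⊥ ∷ f a ⊥ys })

-- Each pivot uses up one vector and one coordinate, so there remain fewer vectors than coordinates.
-- Hence a step without a pivot must come, and there the first unit vector is orthogonal to all that
-- is left.
kernel : ∀ {n} (xs : List (Vec Bool n)) → length xs < n → ∃[ a ] (isZero a ≡ false × All (_⊥ᵛ a) xs)
kernel {suc n} xs len with eliminate xs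
... | inj₁ ⊥xs = true ∷ zeros n , refl , ⊥xs
... | inj₂ (p , ys , leny , f) =
  let a , a≢0 , ⊥ys = kernel ys (≤-pred (subst (_< suc n) (sym leny) len))
  in dot p a ∷ a , trans (cong (not (dot p a) ∧_) a≢0) (∧-zeroʳ _) , f a ⊥ys

basis : ∀ n → List (Vec Bool n)
basis zero = []
basis (suc n) = (true ∷ zeros n) ∷ map (false ∷_) (basis n)

length-basis : ∀ n → length (basis n) ≡ n
length-basis zero = refl
length-basis (suc n) = cong suc (trans (length-map _ (basis n)) (length-basis n))

basis-detects : ∀ {n} (a : Vec Bool n) → isZero a ≡ false → Any (λ x → dot a x ≡ true) (basis n)
basis-detects (true ∷ a) _ = here (cong not (dot-zerosʳ a))
basis-detects (false ∷ a) a≢0 = there (Anyₚ.map⁺ (basis-detects a a≢0))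

-- Karatsuba's bilinear algorithm

-- This is 2^j, defined by doubling so that vectors split into equal halves definitionally.
dim : ℕ → ℕ
dim zero = 1
dim (suc j) = dim j + dim j

-- These correspond to Karatsuba's three products: of the low halves, of the high halves, and of the
-- sums of halves. Testing `a₀ ++ᵛ a₁` against `x ++ᵛ x` is testing `a₀ ⊕ a₁` against `x`.
low high both : ∀ {n} → Vec Bool n × Vec Bool n → Vec Bool (n + n) × Vec Bool (n + n)
low {n} (x , y) = x ++ᵛ zeros n , y ++ᵛ zeros n
high {n} (x , y) = zeros n ++ᵛ x , zeros n ++ᵛ y
both (x , y) = x ++ᵛ x , y ++ᵛ y

karatsuba : ∀ j → List (Vec Bool (dim j) × Vec Bool (dim j))
karatsuba zero = (true ∷ [] , true ∷ []) ∷ []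
karatsuba (suc j) = map low (karatsuba j) ++ map high (karatsuba j) ++ map both (karatsuba j)

length-karatsuba : ∀ j → length (karatsuba j) ≡ 3 ^ j
length-karatsuba zero = refl
length-karatsuba (suc j)
  rewrite length-++ (map low (karatsuba j)) {map high (karatsuba j) ++ map both (karatsuba j)}
        | length-++ (map high (karatsuba j)) {map both (karatsuba j)}
        | length-map low (karatsuba j) | length-map high (karatsuba j) | length-map both (karatsuba j)
        | length-karatsuba j | +-identityʳ (3 ^ j) = refl

Detects : ∀ {n} → Vec Bool n → Vec Bool n → Vec Bool n × Vec Bool n → Set
Detects a b (x , y) = dot a x ≡ true × dot b y ≡ true

-- If both low halves or both high halves are nonzero, those halves are detected. Otherwise one
-- half of a and the opposite half of b vanish, and doubled tests see the remaining halves.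
karatsuba-detects : ∀ j a b → isZero a ≡ false → isZero b ≡ false → Any (Detects a b) (karatsuba j)
karatsuba-detects zero (true ∷ []) (true ∷ []) _ _ = here (refl , refl)
karatsuba-detects (suc j) a b a≢0 b≢0
  with a₀ , a₁ , refl ← splitAt (dim j) a | b₀ , b₁ , refl ← splitAt (dim j) b
  rewrite isZero-++ a₀ {a₁} | isZero-++ b₀ {b₁}
  -- The four zero tests are passed with their equations, so that matching on them keeps the
  -- hypotheses of the recursive calls. The patterns without a clause would make `a` or `b` zero.
  = cases (isZero a₀) (isZero a₁) (isZero b₀) (isZero b₁) refl refl refl refl a≢0 b≢0
  where
  n = dim j
  ks = karatsuba j

  Hit : Vec Bool (n + n) × Vec Bool (n + n) → Set
  Hit = Detects (a₀ ++ᵛ a₁) (b₀ ++ᵛ b₁)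

  on-low : ∀ (u v x : Vec Bool n) → dot u x ≡ true → dot (u ++ᵛ v) (x ++ᵛ zeros n) ≡ true
  on-low u v x e rewrite dot-++ u x {v} {zeros n} | e | dot-zerosʳ v = refl

  on-high : ∀ (u v x : Vec Bool n) → dot v x ≡ true → dot (u ++ᵛ v) (zeros n ++ᵛ x) ≡ true
  on-high u v x e rewrite dot-++ u (zeros n) {v} {x} | e | dot-zerosʳ u = refl

  on-both₀ : ∀ (u v x : Vec Bool n) → isZero v ≡ true → dot u x ≡ true → dot (u ++ᵛ v) (x ++ᵛ x) ≡ true
  on-both₀ u v x z e rewrite dot-++ u x {v} {x} | e | dot-isZeroˡ v x z = refl

  on-both₁ : ∀ (u v x : Vec Bool n) → isZero u ≡ true → dot v x ≡ true → dot (u ++ᵛ v) (x ++ᵛ x) ≡ true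
  on-both₁ u v x z e rewrite dot-++ u x {v} {x} | e | dot-isZeroˡ u x z = refl

  lift : ∀ (a b : Vec Bool n)
         (f : Vec Bool n × Vec Bool n → Vec Bool (n + n) × Vec Bool (n + n)) →
         (∀ x y → dot a x ≡ true → dot b y ≡ true → Hit (f (x , y))) →
         Any (Detects a b) ks → Any Hit (map f ks)
  lift _ _ f h = Anyₚ.map⁺ ∘ Any.map (λ {(x , y)} (e , e′) → h x y e e′)

  cases : ∀ za₀ za₁ zb₀ zb₁ →
    isZero a₀ ≡ za₀ → isZero a₁ ≡ za₁ → isZero b₀ ≡ zb₀ → isZero b₁ ≡ zb₁ →
    za₀ ∧ za₁ ≡ false → zb₀ ∧ zb₁ ≡ false → Any Hit (karatsuba (suc j))
  cases false _ false _ a₀≢0 _ b₀≢0 _ _ _ =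
    Anyₚ.++⁺ˡ (lift a₀ b₀ low (λ x y e e′ → on-low a₀ a₁ x e , on-low b₀ b₁ y e′)
      (karatsuba-detects j a₀ b₀ a₀≢0 b₀≢0))
  cases _ false _ false _ a₁≢0 _ b₁≢0 _ _ =
    Anyₚ.++⁺ʳ (map low ks) (Anyₚ.++⁺ˡ (lift a₁ b₁ high (λ x y e e′ → on-high a₀ a₁ x e , on-high b₀ b₁ y e′)
      (karatsuba-detects j a₁ b₁ a₁≢0 b₁≢0)))
  cases false true true false a₀≢0 a₁≡0 b₀≡0 b₁≢0 _ _ =
    Anyₚ.++⁺ʳ (map low ks) (Anyₚ.++⁺ʳ (map high ks)
      (lift a₀ b₁ both (λ x y e e′ → on-both₀ a₀ a₁ x a₁≡0 e , on-both₁ b₀ b₁ y b₀≡0 e′)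
        (karatsuba-detects j a₀ b₁ a₀≢0 b₁≢0)))
  cases true false false true a₀≡0 a₁≢0 b₀≢0 b₁≡0 _ _ =
    Anyₚ.++⁺ʳ (map low ks) (Anyₚ.++⁺ʳ (map high ks)
      (lift a₁ b₀ both (λ x y e e′ → on-both₁ a₀ a₁ x a₀≡0 e , on-both₀ b₀ b₁ y b₁≡0 e′)
        (karatsuba-detects j a₁ b₀ a₁≢0 b₀≢0)))

-- Paired domination in doubled graphs

-- The vertices are pairs (p , s), and (p , s) is adjacent to (q , flip s) whenever p ~ q. If p ~ p
-- for every p of a dominating family, the family times all signs is matched by flipping signs.
pairedDominating-double : ∀ {N} {P B : Set} (G : Graph N) (code : (P × B) ↔ Fin N)
  (flip : B → B) → (∀ s → flip (flip s) ≡ s) → (_~_ : P → P → Set) →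
  (∀ p q s → p ~ q → Adj G (Inverse.to code (p , s)) (Inverse.to code (q , flip s))) →
  (bs : List B) → (∀ s → s ∈ bs) → (ps : List P) → (∀ p → Any (p ~_) ps) → All (λ p → p ~ p) ps →
  PairedDominating G (fromList (map (Inverse.to code) (cartesianProduct ps bs)))
pairedDominating-double {N} {P} {B} G code flip flip² _~_ edge bs all-bs ps dom loops =
  (λ v → inj₂ (dominated v)) , partner , matched
  where
  open Inverse code using (to; from; strictlyInverseˡ; strictlyInverseʳ)
  D = map to (cartesianProduct ps bs)

  member : ∀ {p} s → p ∈ ps → to (p , s) ∈ˢ fromList D
  member s p∈ = ∈-fromList⁺ (∈-map⁺ to (∈-cartesianProduct⁺ p∈ (all-bs s)))

  dominated : ∀ v → ∃[ u ] (u ∈ˢ fromList D × Adj G v u)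
  dominated v =
    let p , s = from v
        q , q∈ , p~q = find (dom p)
    in to (q , flip s) , member (flip s) q∈ ,
       subst (λ w → Adj G w (to (q , flip s))) (strictlyInverseˡ v) (edge p q s p~q)

  partner : Fin N → Fin N
  partner v = to (proj₁ (from v) , flip (proj₂ (from v)))

  partner-to : ∀ p s → partner (to (p , s)) ≡ to (p , flip s)
  partner-to p s rewrite strictlyInverseʳ (p , s) = refl

  matched : ∀ v → v ∈ˢ fromList D →
            partner v ∈ˢ fromList D × Adj G v (partner v) × partner (partner v) ≡ v
  matched v v∈ with ∈-map⁻ to (∈-fromList⁻ D v∈)
  ... | (p , s) , ps∈ , refl with p∈ , _ ← ∈-cartesianProduct⁻ ps bs ps∈
    rewrite partner-to p s | partner-to p (flip s) | flip² s
    = member (flip s) p∈ , edge p p s (All.lookup loops p∈) , refl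

-- The graph

-- The relation |i - k| ≤ 1. Its reflexivity provides the loops required by
-- `pairedDominating-double`.
near : ℕ → ℕ → Bool
near zero zero = true
near zero (suc k) = k ≡ᵇ 0
near (suc i) zero = i ≡ᵇ 0
near (suc i) (suc k) = near i k

near-sym : ∀ i k → near i k ≡ near k i
near-sym zero zero = refl
near-sym zero (suc k) = refl
near-sym (suc i) zero = refl
near-sym (suc i) (suc k) = near-sym i k

near-refl : ∀ i → near i i ≡ true
near-refl zero = refl
near-refl (suc i) = near-refl i

near-suc : ∀ i → near (suc i) i ≡ true
near-suc zero = refl
near-suc (suc i) = near-suc i

near⇒≤ : ∀ i k → near i k ≡ true → i ≤ suc k
near⇒≤ zero k _ = z≤n
near⇒≤ (suc zero) zero _ = s≤s z≤n
near⇒≤ (suc i) (suc k) e = s≤s (near⇒≤ i k e)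

-- Only nonzero vectors at level 0 are hard to dominate: their neighbours are the vectors at level 1
-- that detect them. All other levels only serve to connect the graph and to make it long.
joined : ∀ {n} → ℕ → Vec Bool n → ℕ → Vec Bool n → Bool
joined zero u zero v = isZero u ∧ isZero v
joined zero u (suc k) v = (k ≡ᵇ 0) ∧ (isZero u ∨ dot u v)
joined (suc i) u zero v = (i ≡ᵇ 0) ∧ (isZero v ∨ dot v u)
joined (suc i) u (suc k) v = near i k

joined-sym : ∀ {n} i (u : Vec Bool n) k v → joined i u k v ≡ joined k v i u
joined-sym zero u zero v = ∧-comm (isZero u) (isZero v)
joined-sym zero u (suc k) v = refl
joined-sym (suc i) u zero v = refl
joined-sym (suc i) u (suc k) v = near-sym i k

-- Levels drop by at most one along a link, so a difference of levels bounds a distance from below.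
joined⇒≤ : ∀ {n} i (u : Vec Bool n) k v → joined i u k v ≡ true → i ≤ suc k
joined⇒≤ zero u k v _ = z≤n
joined⇒≤ (suc zero) u zero v _ = s≤s z≤n
joined⇒≤ (suc i) u (suc k) v e = s≤s (near⇒≤ i k e)

codeVec : ∀ n → Vec Bool n ↔ Fin (2 ^ n)
codeVec zero = mk↔ₛ′ (λ _ → zero) (λ _ → []) (λ { zero → refl }) (λ { [] → refl })
codeVec (suc n) =
  ↔-sym *↔× ↔-∘ ((↔-sym 2↔Bool ×-↔ codeVec n) ↔-∘
    mk↔ₛ′ uncons (uncurry _∷_) (λ _ → refl) (λ { (_ ∷ _) → refl }))

module Construction (d n : ℕ) where

  -- With `2 + d` levels, levels 0 and 1 exist for every `d`, and the top level is `suc d`.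
  Core : Set
  Core = Fin (2 + d) × Vec Bool n

  Link : Core → Core → Set
  Link (i , u) (k , v) = joined (toℕ i) u (toℕ k) v ≡ true

  N : ℕ
  N = ((2 + d) * 2 ^ n) * 2

  abstract
    code : (Core × Bool) ↔ Fin N
    code = ↔-sym *↔× ↔-∘ ((↔-sym *↔× ↔-∘ (↔-id _ ×-↔ codeVec n)) ×-↔ ↔-sym 2↔Bool)

  open Inverse code using (to; from; strictlyInverseˡ; strictlyInverseʳ)

  -- The direct product of the looped graph `Link` with a single edge. A loop becomes an edge
  -- between the two copies, and differing signs ensure irreflexivity.
  adjᶜ : Core × Bool → Core × Bool → Bool
  adjᶜ ((i , u) , s) ((k , v) , t) = joined (toℕ i) u (toℕ k) v ∧ (s xor t)

  G : Graph N
  G = record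
    { adj    = λ x y → adjᶜ (from x) (from y)
    ; symm   = λ x y → sym-adjᶜ (from x) (from y)
    ; irrefl = λ x → irrefl-adjᶜ (from x)
    }
    where
    sym-adjᶜ : ∀ x y → adjᶜ x y ≡ adjᶜ y x
    sym-adjᶜ ((i , u) , s) ((k , v) , t) = cong₂ _∧_ (joined-sym (toℕ i) u (toℕ k) v) (xor-comm s t)
    irrefl-adjᶜ : ∀ x → adjᶜ x x ≡ false
    irrefl-adjᶜ (_ , s) = trans (cong (_ ∧_) (xor-same s)) (∧-zeroʳ _)

  link⇒adj : ∀ x y s → Link x y → Adj G (to (x , s)) (to (y , not s))
  link⇒adj x y s e =
    trans (cong₂ adjᶜ (strictlyInverseʳ (x , s)) (strictlyInverseʳ (y , not s))) (cong₂ _∧_ e (opposite s))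
    where
    opposite : ∀ s → s xor not s ≡ true
    opposite false = refl
    opposite true = refl

  adj⇒link : ∀ x y → Adj G x y → Link (proj₁ (from x)) (proj₁ (from y))
  adj⇒link x y e = proj₁ (∧-true⁻ e)

  -- Dominating sets and the lower bound

  spine : List Core
  spine = map (_, zeros n) (allFin (2 + d))

  -- The spine takes care of all but the nonzero vectors at level 0, and a basis at level 1 detects
  -- those.
  core : List Core
  core = spine ++ map (suc zero ,_) (basis n)

  ∈-spine : ∀ i → (i , zeros n) ∈ spine
  ∈-spine i = ∈-map⁺ (_, zeros n) (∈-allFin i)

  -- At the bottom this uses the disjunct `isZero` in `joined`: the zero vector at level 0 is linked
  -- to all of level 1, though it is detected by nothing.
  link-down : ∀ i u → Link (suc i , u) (inject₁ i , zeros n)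
  link-down zero u = cong (_∨ dot (zeros n) u) (isZero-zeros n)
  link-down (suc i) u = trans (cong (near (suc (toℕ i))) (toℕ-inject₁ i)) (near-suc (toℕ i))

  link-origin : ∀ u → isZero u ≡ true → Link (zero , u) (zero , zeros n)
  link-origin u u≡0 = cong₂ _∧_ u≡0 (isZero-zeros n)

  -- This dichotomy between easy and hard vertices drives domination in `G` and in its square, and
  -- also connectedness.
  classify : ∀ x → Any (Link x) spine ⊎ (∃[ a ] (isZero a ≡ false × x ≡ (zero , a)))
  classify (suc i , u) = inj₁ (lose (∈-spine (inject₁ i)) (link-down i u))
  classify (zero , u) with isZero u in eq
  ... | true = inj₁ (lose (∈-spine zero) (link-origin u eq))
  ... | false = inj₂ (u , eq , refl)

  detect⇒link : ∀ a {x} → isZero a ≡ false → dot a x ≡ true → Link (zero , a) (suc zero , x)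
  detect⇒link a a≢0 e = cong₂ _∨_ a≢0 e

  link⇒detect : ∀ a k x → isZero a ≡ false → Link (zero , a) (k , x) → dot a x ≡ true
  link⇒detect a zero x a≢0 e with () ← trans (sym a≢0) (proj₁ (∧-true⁻ e))
  link⇒detect a (suc zero) x a≢0 e rewrite a≢0 = e

  core-dominates : ∀ x → Any (Link x) core
  core-dominates x with classify x
  ... | inj₁ easy = Anyₚ.++⁺ˡ easy
  ... | inj₂ (a , a≢0 , refl) =
    Anyₚ.++⁺ʳ spine (Anyₚ.map⁺ (Any.map (detect⇒link a a≢0) (basis-detects a a≢0)))

  spine-loops : All (λ x → Link x x) spine
  spine-loops = Allₚ.map⁺ (All.universal loop _)
    where
    loop : ∀ i → Link (i , zeros n) (i , zeros n)
    loop zero = link-origin (zeros n) (isZero-zeros n)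
    loop (suc i) = near-refl (toℕ i)

  core-loops : All (λ x → Link x x) core
  core-loops = Allₚ.++⁺ spine-loops (Allₚ.map⁺ (All.universal (λ _ → refl) _))

  bools : List Bool
  bools = false ∷ true ∷ []

  ∈-bools : ∀ s → s ∈ bools
  ∈-bools false = here refl
  ∈-bools true = there (here refl)

  paired-G : ∃[ D ] PairedDominating G D
  paired-G = _ , pairedDominating-double G code not not-involutive Link link⇒adj
    bools ∈-bools core core-dominates core-loops

  noIsolated : NoIsolated G
  noIsolated v = map₂ proj₂ (paired⇒totally G _ (proj₂ paired-G) v)

  vector : Fin N → Vec Bool n
  vector x = proj₂ (proj₁ (from x))

  -- Fewer than `n` vertices carry fewer than `n` vectors, so `kernel` gives a nonzero `a`
  -- orthogonal to all of them. But the vertex `(zero , a)` needs a neighbour in `D`, whose vector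
  -- must detect `a`.
  paired≥n : ∀ D → PairedDominating G D → n ≤ ∣ D ∣
  paired≥n D pd = ≮⇒≥ λ ∣D∣<n →
    let vs = map vector (elements D)
        a , a≢0 , ⊥vs = kernel vs
          (subst (_< n) (sym (trans (length-map vector (elements D)) (length-elements D))) ∣D∣<n)
        v = to ((zero , a) , false)
        u , u∈D , v~u = paired⇒totally G D pd v
        detected : dot a (vector u) ≡ true
        detected = link⇒detect a (proj₁ (proj₁ (from u))) (vector u) a≢0
          (subst (λ x → Link (proj₁ x) (proj₁ (from u))) (strictlyInverseʳ ((zero , a) , false))
            (adj⇒link v u v~u))
        undetected : dot a (vector u) ≡ false
        undetected = trans (dot-comm a (vector u)) (All.lookup (Allₚ.map⁻ ⊥vs) (∈-elements u∈D))
    in contradiction (trans (sym detected) undetected) λ ()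

  -- Connectedness and diameter

  level : Fin N → ℕ
  level x = toℕ (proj₁ (proj₁ (from x)))

  walk⇒≤ : ∀ {x y k} → Walk G x y k → level x ≤ k + level y
  walk⇒≤ [] = ≤-refl
  walk⇒≤ (_∷_ {x} {z} e w) =
    ≤-trans (joined⇒≤ (level x) _ (level z) _ (adj⇒link x z e)) (s≤s (walk⇒≤ w))

  _++ʷ_ : ∀ {x y z k l} → Walk G x y k → Walk G y z l → Walk G x z (k + l)
  [] ++ʷ w = w
  (e ∷ v) ++ʷ w = e ∷ (v ++ʷ w)

  reverse : ∀ {x y k} → Walk G x y k → ∃[ l ] Walk G y x l
  reverse [] = _ , []
  reverse (_∷_ {x} {z} e w) = _ , proj₂ (reverse w) ++ʷ (trans (symm G z x) e ∷ [])

  origin : Fin N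
  origin = to ((zero , zeros n) , false)

  -- Both signs are included because every step along a link flips the sign.
  Reach : Core → Set
  Reach x = ∀ s → ∃[ k ] Walk G (to (x , s)) origin k

  reach-step : ∀ {x y} → Link x y → Reach y → Reach x
  reach-step {x} {y} e r s = _ , link⇒adj x y s e ∷ proj₂ (r (not s))

  reach-spine : ∀ i → Reach (i , zeros n)
  reach-spine = <-weakInduction (λ i → Reach (i , zeros n)) reach₀
    λ i → reach-step (link-down i (zeros n))
    where
    reach₀ : Reach (zero , zeros n)
    reach₀ false = _ , []
    -- The loop at the origin's core joins its two copies; this is what connects the two signs.
    reach₀ true = _ , link⇒adj _ _ true (link-origin (zeros n) (isZero-zeros n)) ∷ []

  reach : ∀ x → Reach x
  reach x with classify x
  ... | inj₁ easy with find easy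
  ... | z , z∈ , x~z with ∈-map⁻ (_, zeros n) z∈
  ... | i , _ , refl = reach-step x~z (reach-spine i)
  -- A hard vertex goes up to a basis vector detecting it at level 1, then down to the spine.
  reach x | inj₂ (a , a≢0 , refl) with find (basis-detects a a≢0)
  ... | v , _ , e = reach-step {y = suc zero , v} (detect⇒link a a≢0 e)
    (reach-step (link-down zero v) (reach-spine zero))

  connected : Connected G
  connected u v = _ , proj₂ (toOrigin u) ++ʷ proj₂ (reverse (proj₂ (toOrigin v)))
    where
    toOrigin : ∀ x → ∃[ k ] Walk G x origin k
    toOrigin x = subst (λ y → ∃[ k ] Walk G y origin k) (strictlyInverseˡ x) (reach _ _)

  long : ∃[ D ] (Diameter G D × d ≤ D)
  long =
    let D , diam , ≤D = diameter G connected origin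
    -- The far end lies at level `suc d` and the origin at level 0, so their distance exceeds `d`.
    in D , diam , ≤-trans (n≤1+n d) (≤-trans far (≤D far-end origin k (proj₂ dist)))
    where
    far-end : Fin N
    far-end = to ((fromℕ (suc d) , zeros n) , false)
    dist = distance G connected far-end origin
    k = proj₁ dist
    level-to : ∀ i u s → level (to ((i , u) , s)) ≡ toℕ i
    level-to i u s = cong (λ x → toℕ (proj₁ (proj₁ x))) (strictlyInverseʳ ((i , u) , s))
    far : suc d ≤ k
    far = subst₂ _≤_ (trans (level-to (fromℕ (suc d)) _ _) (toℕ-fromℕ (suc d)))
      (trans (cong (k +_) (level-to zero _ _)) (+-identityʳ k)) (walk⇒≤ (proj₁ (proj₂ dist)))

  -- The direct square

  _≈_ : Core × Core → Core × Core → Set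
  (x , y) ≈ (x′ , y′) = Link x x′ × Link y y′

  -- Separating the cores from the signs presents the direct square as a doubled graph again, now
  -- with pairs of signs.
  code² : ((Core × Core) × (Bool × Bool)) ↔ Fin (N * N)
  code² = ↔-sym *↔× ↔-∘ ((code ×-↔ code) ↔-∘
    mk↔ₛ′ (λ ((x , y) , (s , t)) → (x , s) , (y , t)) (λ ((x , s) , (y , t)) → (x , y) , (s , t))
          (λ _ → refl) (λ _ → refl))

  not² : Bool × Bool → Bool × Bool
  not² (s , t) = not s , not t

  link²⇒adj : ∀ p q s → p ≈ q → Adj (G ×ᵍ G) (Inverse.to code² (p , s)) (Inverse.to code² (q , not² s))
  link²⇒adj (x , y) (x′ , y′) (s , t) (e , e′) = trans
    (cong₂ adj² (remQuot-combine {N} {N} (to (x , s)) (to (y , t)))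
                (remQuot-combine {N} {N} (to (x′ , not s)) (to (y′ , not t))))
    (cong₂ _∧_ (link⇒adj x x′ s e) (link⇒adj y y′ t e′))
    where
    adj² : Fin N × Fin N → Fin N × Fin N → Bool
    adj² (a , b) (a′ , b′) = adj G a a′ ∧ adj G b b′

  module _ (ks : List (Vec Bool n × Vec Bool n))
           (ks-detects : ∀ a b → isZero a ≡ false → isZero b ≡ false → Any (Detects a b) ks) where

    raise : Vec Bool n × Vec Bool n → Core × Core
    raise (x , y) = (suc zero , x) , (suc zero , y)

    -- The pairs in `ks` serve two hard coordinates. If one coordinate is easy, the spine suffices
    -- there and `core` is used for the other. Avoiding the product of `core` with itself keeps the
    -- size, apart from `ks`, linear in `n`.
    square : List (Core × Core)
    square = map raise ks ++ (cartesianProduct core spine ++ cartesianProduct spine core)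

    square-dominates : ∀ p → Any (p ≈_) square
    square-dominates (x , y) with classify x
    ... | inj₁ easy = Anyₚ.++⁺ʳ (map raise ks) (Anyₚ.++⁺ʳ (cartesianProduct core spine)
      (Anyₚ.cartesianProduct⁺ easy (core-dominates y)))
    ... | inj₂ (a , a≢0 , refl) with classify y
    ... | inj₁ easy = Anyₚ.++⁺ʳ (map raise ks) (Anyₚ.++⁺ˡ
      (Anyₚ.cartesianProduct⁺ (core-dominates (zero , a)) easy))
    ... | inj₂ (b , b≢0 , refl) = Anyₚ.++⁺ˡ (Anyₚ.map⁺
      (Any.map (λ (e , e′) → detect⇒link a a≢0 e , detect⇒link b b≢0 e′) (ks-detects a b a≢0 b≢0)))

    square-loops : All (λ p → p ≈ p) square
    square-loops = Allₚ.++⁺ (Allₚ.map⁺ (All.universal (λ _ → refl , refl) ks))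
      (Allₚ.++⁺ (product core-loops spine-loops) (product spine-loops core-loops))
      where
      product : ∀ {xs ys} → All (λ x → Link x x) xs → All (λ y → Link y y) ys →
                All (λ p → p ≈ p) (cartesianProduct xs ys)
      product {xs} {ys} lx ly = All.tabulate λ p∈ →
        let x∈ , y∈ = ∈-cartesianProduct⁻ xs ys p∈ in All.lookup lx x∈ , All.lookup ly y∈

    bools² : List (Bool × Bool)
    bools² = cartesianProduct bools bools

    D² : List (Fin (N * N))
    D² = map (Inverse.to code²) (cartesianProduct square bools²)

    paired-G² : PairedDominating (G ×ᵍ G) (fromList D²)
    paired-G² = pairedDominating-double (G ×ᵍ G) code² not²
      (λ (s , t) → cong₂ _,_ (not-involutive s) (not-involutive t)) _≈_ link²⇒adj
      bools² (λ (s , t) → ∈-cartesianProduct⁺ (∈-bools s) (∈-bools t))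
      square square-dominates square-loops

    length-spine : length spine ≡ 2 + d
    length-spine = trans (length-map (_, zeros n) (allFin (2 + d))) (length-tabulate {n = 2 + d} id)

    length-core : length core ≡ (2 + d) + n
    length-core = trans (length-++ spine)
      (cong₂ _+_ length-spine (trans (length-map _ (basis n)) (length-basis n)))

    -- The factor 4 counts the pairs of signs.
    length-D² : length D² ≡ (length ks + (((2 + d) + n) * (2 + d) + (2 + d) * ((2 + d) + n))) * 4
    length-D² = trans (length-map (Inverse.to code²) (cartesianProduct square bools²))
      (trans (length-cartesianProductWith _,_ square bools²) (cong (_* 4) length-square))
      where
      length-product : ∀ xs ys {k l} → length xs ≡ k → length ys ≡ l →
                       length (cartesianProduct {A = Core} {B = Core} xs ys) ≡ k * l
      length-product xs ys ek el = trans (length-cartesianProductWith _,_ xs ys) (cong₂ _*_ ek el)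
      length-square : length square ≡ length ks + (((2 + d) + n) * (2 + d) + (2 + d) * ((2 + d) + n))
      length-square = trans (length-++ (map raise ks)) (cong₂ _+_ (length-map raise ks)
        (trans (length-++ (cartesianProduct core spine))
          (cong₂ _+_ (length-product core spine length-core length-spine)
                     (length-product spine core length-spine length-core))))

-- Growth

-- Absorbs the terms linear in `n` into the main term 3^j.
dim≤3^ : ∀ j → dim j ≤ 3 ^ j
dim≤3^ zero = ≤-refl
dim≤3^ (suc j) = +-mono-≤ (dim≤3^ j) (≤-trans (dim≤3^ j) (m≤m+n _ _))

1≤3^ : ∀ j → 1 ≤ 3 ^ j
1≤3^ zero = ≤-refl
1≤3^ (suc j) = ≤-trans (1≤3^ j) (m≤m+n _ _)

-- Bernoulli's inequality for (4/3)^j, where 4^j is the square of dim j.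
bernoulli : ∀ j → (3 + j) * 3 ^ j ≤ 3 * (dim j * dim j)
bernoulli zero = ≤-refl
bernoulli (suc j) = begin
  (4 + j) * (3 * t)             ≤⟨ m≤m+n _ (j * t) ⟩
  (4 + j) * (3 * t) + j * t     ≡⟨ expand j t ⟩
  4 * ((3 + j) * t)             ≤⟨ *-monoʳ-≤ 4 (bernoulli j) ⟩
  4 * (3 * (m * m))             ≡⟨ regroup m ⟩
  3 * ((m + m) * (m + m))       ∎
  where
  open ≤-Reasoning
  t = 3 ^ j
  m = dim j
  expand : ∀ j t → (4 + j) * (3 * t) + j * t ≡ 4 * ((3 + j) * t)
  expand = solve-∀
  regroup : ∀ m → 4 * (3 * (m * m)) ≡ 3 * ((m + m) * (m + m))
  regroup = solve-∀

-- For j = 3c, `bernoulli` says (1 + c) 3^j ≤ 4^j; the spare 3^j is positive and makes the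
-- inequality strict.
dim²-beats : ∀ c → c * 3 ^ (3 * c) < dim (3 * c) * dim (3 * c)
dim²-beats c = *-cancelˡ-< 3 _ _ (begin-strict
  3 * (c * t)               ≡⟨ regroup c t ⟩
  3 * c * t                 <⟨ +-monoˡ-≤ (3 * c * t) (≤-trans (1≤3^ (3 * c)) (m≤m+n t _)) ⟩
  3 * t + 3 * c * t         ≡⟨ *-distribʳ-+ t 3 (3 * c) ⟨
  (3 + 3 * c) * t           ≤⟨ bernoulli (3 * c) ⟩
  3 * (dim (3 * c) * dim (3 * c)) ∎)
  where
  open ≤-Reasoning
  t = 3 ^ (3 * c)
  regroup : ∀ c t → 3 * (c * t) ≡ 3 * c * t
  regroup = solve-∀

-- Every real c > 0 is at least some positive rational p/q, so these ratios suffice; the inequality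
-- is multiplied out by `q`.
theorem1 : (p q : ℕ) → 1 ≤ p → 1 ≤ q → (d : ℕ) → 1 ≤ d →
    ∃[ n ] Σ (Graph n) λ G →
    Connected G × NoIsolated G
    × (∃[ D ] (Diameter G D × d ≤ D))
    × ∃[ g ] ∃[ h ] (PairedDomNumber G g × PairedDomNumber (G ×ᵍ G) h
    × q * h < p * g ^ 2)
theorem1 p q 1≤p _ d _ =
  N , G , connected , noIsolated , long , g , h ,
  proj₁ (proj₂ γ) , proj₁ (proj₂ γ²) , bound
  where
  L = 2 + d
  -- Since L + n ≤ (L + 1) 3^j, the paired dominating set of the square has at most (1 + 2L(L + 1))
  -- 4 · 3^j elements; `c` is `q` times this constant, which is independent of `j`.
  c = q * ((1 + ((L + 1) * L + L * (L + 1))) * 4)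
  j = 3 * c
  n = dim j
  t = 3 ^ j
  open Construction d n
  ks = karatsuba j

  γ = pairedDomNumber G _ (proj₂ paired-G)
  γ² = pairedDomNumber (G ×ᵍ G) _ (paired-G² ks (karatsuba-detects j))
  g = proj₁ γ
  h = proj₁ γ²

  n≤g : n ≤ g
  n≤g with D , pd , ∣D∣≡g ← proj₁ (proj₁ (proj₂ γ)) = subst (n ≤_) ∣D∣≡g (paired≥n D pd)

  open ≤-Reasoning

  L+n≤ : L + n ≤ (L + 1) * t
  L+n≤ = begin
    L + n            ≡⟨ cong (_+ n) (*-identityʳ L) ⟨
    L * 1 + n        ≤⟨ +-mono-≤ (*-monoʳ-≤ L (1≤3^ j)) (dim≤3^ j) ⟩
    L * t + t        ≡⟨ regroup L t ⟩
    (L + 1) * t      ∎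
    where
    regroup : ∀ L t → L * t + t ≡ (L + 1) * t
    regroup = solve-∀

  h≤ : h ≤ (t + ((L + n) * L + L * (L + n))) * 4
  h≤ = begin
    h                                                ≤⟨ proj₂ (proj₂ γ²) ⟩
    ∣ fromList (D² ks (karatsuba-detects j)) ∣       ≤⟨ ∣fromList∣≤length (D² ks (karatsuba-detects j)) ⟩
    length (D² ks (karatsuba-detects j))             ≡⟨ length-D² ks (karatsuba-detects j) ⟩
    (length ks + ((L + n) * L + L * (L + n))) * 4    ≡⟨ cong (λ k → (k + ((L + n) * L + L * (L + n))) * 4) (length-karatsuba j) ⟩
    (t + ((L + n) * L + L * (L + n))) * 4            ∎

  bound : q * h < p * g ^ 2
  bound = begin-strict
    q * h                                                          ≤⟨ *-monoʳ-≤ q h≤ ⟩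
    q * ((t + ((L + n) * L + L * (L + n))) * 4)                    ≤⟨ *-monoʳ-≤ q (*-monoˡ-≤ 4 (+-monoʳ-≤ t
                                                                        (+-mono-≤ (*-monoˡ-≤ L L+n≤) (*-monoʳ-≤ L L+n≤)))) ⟩
    q * ((t + ((L + 1) * t * L + L * ((L + 1) * t))) * 4)          ≡⟨ regroup q L t ⟩
    c * t                                                          <⟨ dim²-beats c ⟩
    n * n                                                          ≤⟨ *-mono-≤ n≤g n≤g ⟩
    g * g                                                          ≡⟨ square-pow g ⟩
    1 * g ^ 2                                                      ≤⟨ *-monoˡ-≤ (g ^ 2) 1≤p ⟩
    p * g ^ 2                                                      ∎
    where
    regroup : ∀ q L t → q * ((t + ((L + 1) * t * L + L * ((L + 1) * t))) * 4)
                        ≡ q * ((1 + ((L + 1) * L + L * (L + 1))) * 4) * t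
    regroup = solve-∀
    square-pow : ∀ g → g * g ≡ 1 * (g * (g * 1))
    square-pow = solve-∀
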